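{- Let $X$ be a finite set of cardinality $n$ and let $N=\binom{n}{2}$. There are exactly $$\sum_{c=1}^n\sum_{k=0}^N\binom{N}{k}S(n+k,c)\sum_{m=1}^{N-k}S(N-k,m)\,2^{N-k-m}$$ different principal right ideals in $\mathcal{M}(X)$.
   Context: $\mathcal{M}(X)=X^{X\times X}$ is the set of all binary operations on $X$, a monoid under $\triangleright$ defined by $a(\circ\triangleright\ast)b=(a\circ b)\ast(b\circ a)$ for all $\circ,\ast\in\mathcal{M}(X)$ and $a,b\in X$, with identity the left zeros operation $a\circ_{lz}b=a$. The principal right ideal generated by $\ast\in\mathcal{M}(X)$ is $\{\ast\triangleright\circ:\circ\in\mathcal{M}(X)\}$. $S(p,q)$ denotes the Stirling number of the second kind (the number of partitions of a $p$-element set into $q$ nonempty blocks).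
   Formalization: The inner sum starts at m=0 instead of m=1, so that the k=N term counts with factor S(0,0)=1 (as printed, n=1 would give 0 ideals instead of 1), and X is assumed nonempty (for n=0 the formula gives 0 but there is one ideal). -}

module Defs where

open import Algebra.Bundles using (Monoid)
open import Algebra.Core using (Op₂)
open import Data.Empty using (⊥-elim)
open import Data.Fin.Base using (Fin; zero; suc; punchOut; punchIn)
open import Data.Fin.Properties as Fin
  using (any?; +↔⊎; *↔×; punchOut-cong; punchOut-injective; punchInᵢ≢i; punchOut-punchIn)
open import Data.List.Base using (applyUpTo)
open import Data.Nat.Base using (ℕ; zero; suc; _+_; _*_; _∸_)
open import Data.Nat.ListAction using (sum)
open import Data.Product using (Σ; ∃; ∃!; _×_; _,_; proj₁; proj₂)
open import Data.Sum.Base using (_⊎_; inj₁; inj₂)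
open import Function.Base using (_∘_)
open import Function.Bundles using (Inverse; _↔_)
open import Function.Construct.Composition using () renaming (inverse to _then_)
open import Function.Construct.Identity using (↔-id)
open import Function.Construct.Symmetry using () renaming (inverse to flip)
open import Data.Sum.Function.Propositional using (_⊎-↔_)
open import Level using (Level; _⊔_; 0ℓ) renaming (suc to lsuc)
open import Relation.Binary.Bundles using (Setoid)
import Relation.Binary.Construct.On as On
open import Relation.Binary.PropositionalEquality
  using (_≡_; _≢_; refl; sym; trans; cong; cong₂; setoid)
open import Relation.Nullary using (yes; no; contradiction)
open import Relation.Unary using (Pred; Satisfiable; _∈_; _≐_)
open import Relation.Unary.Properties using (≐-refl; ≐-trans)
open import Relation.Unary.Relation.Binary.Equality using (≐-setoid)

private
  variable
    a c ℓ : Level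
    p q : ℕ

HasCardinality : Setoid c ℓ → ℕ → Set (c ⊔ ℓ)
HasCardinality S n = Inverse S (setoid (Fin n))

-- Both bounds are included; the sum is empty when the upper bound is smaller
-- than the lower one.
sumFromTo : ℕ → ℕ → (ℕ → ℕ) → ℕ
sumFromTo a b f = sum (applyUpTo (λ i → f (a + i)) (suc b ∸ a))

syntax sumFromTo a b (λ i → e) = ∑[ i ∈ a ⋯ b ] e
infix 6 sumFromTo

------------------------------------------------------------------------
-- Binary operations

module _ {X : Set a} where

  infixl 7 _▷_

  _▷_ : Op₂ (Op₂ X)
  (_∘′_ ▷ _∗_) x y = (x ∘′ y) ∗ (y ∘′ x)

  leftZeros : Op₂ X
  leftZeros x y = x

-- Operations are compared by their values, as function extensionality is not
-- available.
𝓜 : Set a → Monoid a a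
𝓜 X = record
  { Carrier  = Op₂ X
  ; _≈_      = λ f g → ∀ x y → f x y ≡ g x y
  ; _∙_      = _▷_
  ; ε        = leftZeros
  ; isMonoid = record
    { isSemigroup = record
      { isMagma = record
        { isEquivalence = record
          { refl  = λ x y → refl
          ; sym   = λ f≈g x y → sym (f≈g x y)
          ; trans = λ f≈g g≈h x y → trans (f≈g x y) (g≈h x y)
          }
        ; ∙-cong = λ {_} {f′} {g} f≈f′ g≈g′ x y →
            trans (cong₂ g (f≈f′ x y) (f≈f′ y x)) (g≈g′ (f′ x y) (f′ y x))
        }
      ; assoc = λ f g h x y → refl
      }
    ; identity = (λ f x y → refl) , (λ f x y → refl)
    }
  }

------------------------------------------------------------------------
-- Principal right ideals

module _ (M : Monoid c ℓ) where
  open Monoid M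

  principalRightIdeal : Carrier → Pred Carrier (c ⊔ ℓ)
  principalRightIdeal x y = ∃ λ z → y ≈ x ∙ z

  IsPrincipalRightIdeal : Pred Carrier (c ⊔ ℓ) → Set (c ⊔ ℓ)
  IsPrincipalRightIdeal I = ∃ λ x → I ≐ principalRightIdeal x

  PrincipalRightIdeals : Setoid (lsuc (c ⊔ ℓ)) (c ⊔ ℓ)
  PrincipalRightIdeals =
    On.setoid {B = Σ _ IsPrincipalRightIdeal} (≐-setoid Carrier (c ⊔ ℓ)) proj₁

------------------------------------------------------------------------
-- Partitions and Stirling numbers of the second kind

-- Nonemptiness and uniqueness make the q blocks pairwise distinct.
record Partition (A : Set) (q : ℕ) : Set₁ where
  field
    block    : Fin q → Pred A 0ℓ
    nonempty : ∀ k → Satisfiable (block k)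
    unique   : ∀ x → ∃! _≡_ λ k → x ∈ block k

  label : A → Fin q
  label x = proj₁ (unique x)

  label-∈ : ∀ x → x ∈ block (label x)
  label-∈ x = proj₁ (proj₂ (unique x))

  ∈-label : ∀ {x k} → x ∈ block k → label x ≡ k
  ∈-label {x} = proj₂ (proj₂ (unique x))

open Partition

module _ {A : Set} where

  infix 4 _⊑_ _≋_

  _⊑_ : Partition A q → Partition A q → Set
  P ⊑ Q = ∀ k → ∃ λ l → block P k ≐ block Q l

  -- Equality of the sets of blocks: their numbering is immaterial.
  _≋_ : Partition A q → Partition A q → Set
  P ≋ Q = P ⊑ Q × Q ⊑ P

  ⊑-refl : {P : Partition A q} → P ⊑ P
  ⊑-refl k = k , ≐-refl

  ⊑-trans : {P Q R : Partition A q} → P ⊑ Q → Q ⊑ R → P ⊑ R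
  ⊑-trans P⊑Q Q⊑R k with P⊑Q k
  ... | l , Pk≐Ql with Q⊑R l
  ... | m , Ql≐Rm = m , ≐-trans Pk≐Ql Ql≐Rm

Partitions : Set → ℕ → Setoid (lsuc 0ℓ) 0ℓ
Partitions A q = record
  { Carrier       = Partition A q
  ; _≈_           = _≋_
  ; isEquivalence = record
    { refl  = λ {P} → ⊑-refl {P = P} , ⊑-refl {P = P}
    ; sym   = λ (P⊑Q , Q⊑P) → Q⊑P , P⊑Q
    ; trans = λ {P} {Q} {R} (P⊑Q , Q⊑P) (Q⊑R , R⊑Q) →
        ⊑-trans {P = P} {Q} {R} P⊑Q Q⊑R , ⊑-trans {P = R} {Q} {P} R⊑Q Q⊑P
    }
  }

-- f ≲ g: the kernel of f is contained in that of g.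
infix 4 _≲_
_≲_ : {A B C : Set} → (A → B) → (A → C) → Set
f ≲ g = ∀ i j → f i ≡ f j → g i ≡ g j

⊑⇒≲ : {A : Set} (P Q : Partition A q) → P ⊑ Q → label P ≲ label Q
⊑⇒≲ P Q P⊑Q i j eq with P⊑Q (label P i)
... | l , (Pk⊆Ql , _) = trans (∈-label Q (Pk⊆Ql (label-∈ P i)))
  (sym (∈-label Q (Pk⊆Ql (∈-block eq))))
  where
  ∈-block : ∀ {k} → k ≡ label P j → j ∈ block P k
  ∈-block refl = label-∈ P j

≲⇒⊑ : {A : Set} (P Q : Partition A q) →
      label P ≲ label Q → label Q ≲ label P → P ⊑ Q
≲⇒⊑ P Q P≲Q Q≲P k with nonempty P k
... | i , i∈Pk = label Q i ,
  (λ {x} x∈Pk → move Q (P≲Q x i (trans (∈-label P x∈Pk) (sym (∈-label P i∈Pk))))) ,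
  (λ {x} x∈Ql → move P (trans (Q≲P x i (∈-label Q x∈Ql)) (∈-label P i∈Pk)))
  where
  move : ∀ (R : Partition _ _) {x l} → label R x ≡ l → x ∈ block R l
  move R {x} refl = label-∈ R x

fibres : {A : Set} (f : A → Fin q) → (∀ k → ∃ λ i → f i ≡ k) → Partition A q
fibres f onto = record
  { block    = λ k i → f i ≡ k
  ; nonempty = onto
  ; unique   = λ i → f i , refl , λ eq → eq
  }

onto : {A : Set} (P : Partition A q) → ∀ k → ∃ λ i → label P i ≡ k
onto P k with nonempty P k
... | i , i∈Pk = i , ∈-label P i∈Pk

-- An irredundant and complete enumeration of the partitions.
record Enumeration (I : Set) (p q : ℕ) : Set₁ where
  field
    part : I → Partition (Fin p) q
    inj  : ∀ c d → label (part c) ≲ label (part d) →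
           label (part d) ≲ label (part c) → c ≡ d
    code : (P : Partition (Fin p) q) → I
    ≲P   : ∀ P → label (part (code P)) ≲ label P
    P≲   : ∀ P → label P ≲ label (part (code P))

open Enumeration

enumeration⇒cardinality : ∀ {I n} → Fin n ↔ I → Enumeration I p q →
                          HasCardinality (Partitions (Fin p) q) n
enumeration⇒cardinality {p} {q} {I} Fin↔I E = enum then flip Fin↔I
  where
  enum : Inverse (Partitions (Fin p) q) (setoid I)
  enum = record
    { to        = code E
    ; from      = part E
    ; to-cong   = λ {P} {Q} (P⊑Q , Q⊑P) → inj E _ _
        (λ i j → P≲ E Q i j ∘ ⊑⇒≲ P Q P⊑Q i j ∘ ≲P E P i j)
        (λ i j → P≲ E P i j ∘ ⊑⇒≲ Q P Q⊑P i j ∘ ≲P E Q i j)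
    ; from-cong = λ { {c} refl → ⊑-refl {P = part E c} , ⊑-refl {P = part E c} }
    ; inverse   =
        (λ {c} {P} (P⊑c , c⊑P) → inj E _ _
          (λ i j → ⊑⇒≲ P (part E c) P⊑c i j ∘ ≲P E P i j)
          (λ i j → P≲ E P i j ∘ ⊑⇒≲ (part E c) P c⊑P i j)) ,
        (λ { {P} refl →
          ≲⇒⊑ (part E (code E P)) P (≲P E P) (P≲ E P) ,
          ≲⇒⊑ P (part E (code E P)) (P≲ E P) (≲P E P) })
    }

cardinality⇒enumeration : ∀ {n} → HasCardinality (Partitions (Fin p) q) n →
                          Enumeration (Fin n) p q
cardinality⇒enumeration {p} {q} B = record
  { part = from
  ; inj  = λ c d c≲d d≲c → trans (sym (strictlyInverseˡ c)) (trans
      (to-cong (≲⇒⊑ (from c) (from d) c≲d d≲c , ≲⇒⊑ (from d) (from c) d≲c c≲d))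
      (strictlyInverseˡ d))
  ; code = to
  ; ≲P   = λ P → ⊑⇒≲ (from (to P)) P (proj₁ (strictlyInverseʳ P))
  ; P≲   = λ P → ⊑⇒≲ P (from (to P)) (proj₂ (strictlyInverseʳ P))
  }
  where open Inverse B

-- A partition of p + 1 elements into q + 1 blocks either has the new element
-- in one of the q + 1 blocks of a partition of the others, or on its own.
module Step (p q : ℕ) {I J : Set}
            (E : Enumeration I p (suc q)) (F : Enumeration J p q) where

  join : Partition (Fin p) (suc q) → Fin (suc q) → Partition (Fin (suc p)) (suc q)
  join P k = fibres (λ { zero → k ; (suc i) → label P i })
    (λ l → let i , eq = onto P l in suc i , eq)

  alone : Partition (Fin p) q → Partition (Fin (suc p)) (suc q)
  alone P = fibres (λ { zero → zero ; (suc i) → suc (label P i) })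
    (λ { zero → zero , refl ; (suc l) → let i , eq = onto P l in suc i , cong suc eq })

  part′ : I × Fin (suc q) ⊎ J → Partition (Fin (suc p)) (suc q)
  part′ (inj₁ (c , k)) = join (part E c) k
  part′ (inj₂ d)       = alone (part F d)

  inj′ : ∀ c d → label (part′ c) ≲ label (part′ d) →
         label (part′ d) ≲ label (part′ c) → c ≡ d
  inj′ (inj₁ (c , k)) (inj₁ (d , l)) c≲d d≲c
    with refl ← inj E c d (λ i j → c≲d (suc i) (suc j)) (λ i j → d≲c (suc i) (suc j))
    with i , eq ← onto (part E c) k
    = cong (λ m → inj₁ (c , m)) (sym (trans (c≲d zero (suc i) (sym eq)) eq))
  inj′ (inj₁ (c , k)) (inj₂ d) c≲d d≲c with onto (part E c) k
  ... | i , eq with () ← c≲d zero (suc i) (sym eq)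
  inj′ (inj₂ c) (inj₁ (d , l)) c≲d d≲c with onto (part E d) l
  ... | i , eq with () ← d≲c zero (suc i) (sym eq)
  inj′ (inj₂ c) (inj₂ d) c≲d d≲c = cong inj₂ (inj F c d
    (λ i j → Fin.suc-injective ∘ c≲d (suc i) (suc j) ∘ cong suc)
    (λ i j → Fin.suc-injective ∘ d≲c (suc i) (suc j) ∘ cong suc))

  complete : (P : Partition (Fin (suc p)) (suc q)) →
             ∃ λ c → label (part′ c) ≲ label P × label P ≲ label (part′ c)
  complete P with any? (λ j → label P (suc j) Fin.≟ label P zero)
  ... | yes (j , eq) = inj₁ (code E P′ , label C j) , C≲P , P≲C
    where
    onto′ : ∀ k → ∃ λ i → label P (suc i) ≡ k
    onto′ k with onto P k
    ... | zero  , eq′ = j , trans eq eq′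
    ... | suc i , eq′ = i , eq′

    P′ = fibres (label P ∘ suc) onto′
    C  = part E (code E P′)

    C≲P : label (join C (label C j)) ≲ label P
    C≲P zero    zero    _   = refl
    C≲P zero    (suc i) eq′ = trans (sym eq) (≲P E P′ j i eq′)
    C≲P (suc i) zero    eq′ = trans (≲P E P′ i j eq′) eq
    C≲P (suc i) (suc k) eq′ = ≲P E P′ i k eq′

    P≲C : label P ≲ label (join C (label C j))
    P≲C zero    zero    _   = refl
    P≲C zero    (suc i) eq′ = P≲ E P′ j i (trans eq eq′)
    P≲C (suc i) zero    eq′ = P≲ E P′ i j (trans eq′ (sym eq))
    P≲C (suc i) (suc k) eq′ = P≲ E P′ i k eq′
  ... | no none = inj₂ (code F P′) , C≲P , P≲C
    where
    ne : ∀ i → label P zero ≢ label P (suc i)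
    ne i eq = none (i , sym eq)

    onto′ : ∀ k → ∃ λ i → punchOut (ne i) ≡ k
    onto′ k with onto P (punchIn (label P zero) k)
    ... | zero  , eq = contradiction (sym eq) (punchInᵢ≢i (label P zero) k)
    ... | suc i , eq = i , trans (punchOut-cong (label P zero) eq) (punchOut-punchIn (label P zero))

    P′ = fibres (λ i → punchOut (ne i)) onto′
    C  = part F (code F P′)

    C≲P : label (alone C) ≲ label P
    C≲P zero    zero    _  = refl
    C≲P (suc i) (suc k) eq =
      punchOut-injective (ne i) (ne k) (≲P F P′ i k (Fin.suc-injective eq))

    P≲C : label P ≲ label (alone C)
    P≲C zero    zero    _  = refl
    P≲C zero    (suc i) eq = contradiction eq (ne i)
    P≲C (suc i) zero    eq = contradiction (sym eq) (ne i)
    P≲C (suc i) (suc k) eq = cong suc (P≲ F P′ i k (punchOut-cong (label P zero) eq))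

  step : Enumeration (I × Fin (suc q) ⊎ J) (suc p) (suc q)
  step = record
    { part = part′
    ; inj  = inj′
    ; code = proj₁ ∘ complete
    ; ≲P   = proj₁ ∘ proj₂ ∘ complete
    ; P≲   = proj₂ ∘ proj₂ ∘ complete
    }

partitions-finite : ∀ p q → ∃ (HasCardinality (Partitions (Fin p) q))
partitions-finite zero zero = 1 , record
  { to        = λ _ → zero
  ; from      = λ _ → fibres (λ ()) (λ ())
  ; to-cong   = λ _ → refl
  ; from-cong = λ _ → (λ ()) , (λ ())
  ; inverse   = (λ { {zero} _ → refl }) , (λ _ → (λ ()) , (λ ()))
  }
partitions-finite zero (suc q) = 0 , record
  { to        = λ P → absurd P
  ; from      = λ ()
  ; to-cong   = λ {P} _ → ⊥-elim (Fin.¬Fin0 (absurd P))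
  ; from-cong = λ { {()} }
  ; inverse   = (λ { {()} }) , (λ { {_} {()} })
  }
  where
  absurd : Partition (Fin 0) (suc q) → Fin 0
  absurd P = proj₁ (nonempty P zero)
partitions-finite (suc p) zero = 0 , record
  { to        = λ P → label P zero
  ; from      = λ ()
  ; to-cong   = λ {P} _ → ⊥-elim (Fin.¬Fin0 (label P zero))
  ; from-cong = λ { {()} }
  ; inverse   = (λ { {()} }) , (λ { {_} {()} })
  }
partitions-finite (suc p) (suc q) =
  let s , B = partitions-finite p (suc q)
      t , C = partitions-finite p q
  in s * suc q + t , enumeration⇒cardinality
       (+↔⊎ then (*↔× ⊎-↔ ↔-id _))
       (Step.step p q (cardinality⇒enumeration B) (cardinality⇒enumeration C))

S : ℕ → ℕ → ℕ
S p q = proj₁ (partitions-finite p q)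

{-# OPTIONS --safe #-}
module Submission where

-- The right ideal of f is determined by the kernel of (x , y) ↦ (f x y , f y x),
-- and the maps of this form are those X × X → X × X that commute with the
-- interchange of coordinates, which has n fixed points and N = n C 2 free orbits.
-- Choose the k free orbits that are sent to fixed points.  They are collapsed, so
-- the kernel on them and the diagonal is a partition of n + k elements into at
-- most n blocks.  On the other orbits it is a partition into m blocks together
-- with, for every orbit except one representative of each block, one of two ways
-- of identifying it with its representative.

open import Defs
open import Algebra.Core using (Op₂)
import Algebra.Properties.CommutativeSemigroup as CommutativeSemigroupProperties
open import Data.Bool.Base using (Bool; true; false; _xor_)
open import Data.Bool.Properties as Bool using (xor-assoc; xor-same; xor-identityʳ; not-¬)
open import Data.Fin.Base
  using (Fin; zero; suc; toℕ; fromℕ<; inject≤; punchIn; punchOut; finToFun; funToFin; combine;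
         splitAt; join; _↑ˡ_; _↑ʳ_)
open import Data.Fin.Properties as Fin
  using (any?; all?; +↔⊎; *↔×; 2↔Bool; toℕ<n; toℕ-fromℕ<; toℕ-injective; injective⇒≤;
         inject≤-injective; ¬∀⟶∃¬; punchIn-punchOut; punchOut-injective; punchOut-cong;
         funToFin-finToFin; finToFun-funToFin; splitAt-↑ˡ; splitAt-↑ʳ; join-splitAt)
open import Data.List.Base using (applyUpTo)
open import Data.Nat.Base
  using (ℕ; zero; suc; _+_; _*_; _∸_; _^_; _≤_; _<_; NonZero; z≤n; s≤s; s≤s⁻¹)
open import Data.Nat.Combinatorics using (_C_; nCk+nC[k+1]≡[n+1]C[k+1]; nC1≡n; k>n⇒nCk≡0)
open import Data.Nat.ListAction using (sum)
open import Data.Nat.Properties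
  using (≡-irrelevant; +-identityʳ; +-suc; +-assoc; *-distribˡ-+; *-distribʳ-+; *-zeroʳ; *-assoc;
         ≤-refl; ≤-reflexive; ≤-trans; ≤-antisym; n≤1+n; n<1+n; m≤n⇒m≤1+n; +-∸-assoc;
         +-commutativeSemigroup)
open import Data.Product as Product using (Σ; ∃; _×_; _,_; proj₁; proj₂; swap; uncurry)
open import Data.Product.Function.NonDependent.Propositional using (_×-↔_)
open import Data.Product.Function.NonDependent.Setoid using (_×-inverse_)
import Data.Product.Properties as Product
open import Data.Product.Relation.Binary.Pointwise.NonDependent
  using (_×ₛ_) renaming (Pointwise-≡↔≡ to ×ₛ≡↔)
open import Data.Sum.Base using (_⊎_; inj₁; inj₂; [_,_])
open import Data.Sum.Function.Propositional using (_⊎-↔_)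
open import Data.Sum.Function.Setoid using (_⊎-inverse_)
import Data.Sum.Properties as Sum
open import Data.Sum.Relation.Binary.Pointwise
  using (_⊎ₛ_; inj₁; inj₂) renaming (Pointwise-≡↔≡ to ⊎ₛ≡↔)
open import Data.Vec.Functional using (_∷_; insertAt; removeAt)
open import Data.Vec.Functional.Properties
  using (insertAt-lookup; insertAt-punchIn; insertAt-removeAt)
open import Function.Base using (_∘_; id)
open import Function.Bundles using (Inverse; _↔_; mk↔ₛ′; module Injection)
open import Function.Construct.Composition using () renaming (inverse to _then_)
open import Function.Construct.Identity using (↔-id)
open import Function.Construct.Symmetry using () renaming (inverse to flip)
open import Function.Properties.Inverse using (↔⇒↣)
open import Level using (Level; 0ℓ)
open import Relation.Binary.Bundles using (Setoid)
import Relation.Binary.Construct.On as On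
open import Relation.Binary.Definitions using (DecidableEquality)
open import Relation.Binary.PropositionalEquality
  using (_≡_; _≢_; _≗_; _→-setoid_; refl; sym; trans; cong; cong₂; subst; setoid;
         module ≡-Reasoning)
open import Relation.Nullary using (¬_; yes; no; contradiction)
open import Relation.Unary using (_⊆_; _∈_)
open import Relation.Unary.Properties using (≐-refl; ≐-sym; ≐-trans)

private
  variable
    a b ℓ₁ ℓ₂ : Level
    m n p q : ℕ

-- Finite sums and binomial sums.

∑-cong : ∀ {f g : ℕ → ℕ} n → (∀ {i} → i < n → f i ≡ g i) →
         sum (applyUpTo f n) ≡ sum (applyUpTo g n)
∑-cong zero    f≗g = refl
∑-cong (suc n) f≗g = cong₂ _+_ (f≗g (s≤s z≤n)) (∑-cong n (f≗g ∘ s≤s))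

∑-zero : ∀ n → sum (applyUpTo (λ _ → 0) n) ≡ 0
∑-zero zero    = refl
∑-zero (suc n) = ∑-zero n

∑-+ : ∀ (f g : ℕ → ℕ) n →
      sum (applyUpTo (λ i → f i + g i) n) ≡ sum (applyUpTo f n) + sum (applyUpTo g n)
∑-+ f g zero    = refl
∑-+ f g (suc n) = trans (cong (f 0 + g 0 +_) (∑-+ (f ∘ suc) (g ∘ suc) n))
  (interchange (f 0) (g 0) (sum (applyUpTo (f ∘ suc) n)) (sum (applyUpTo (g ∘ suc) n)))
  where open CommutativeSemigroupProperties +-commutativeSemigroup using (interchange)

*-∑ : ∀ x (f : ℕ → ℕ) n → x * sum (applyUpTo f n) ≡ sum (applyUpTo (λ i → x * f i) n)
*-∑ x f zero    = *-zeroʳ x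
*-∑ x f (suc n) = trans (*-distribˡ-+ x (f 0) _) (cong (x * f 0 +_) (*-∑ x (f ∘ suc) n))

∑-* : ∀ x (f : ℕ → ℕ) n → sum (applyUpTo f n) * x ≡ sum (applyUpTo (λ i → f i * x) n)
∑-* x f zero    = refl
∑-* x f (suc n) = trans (*-distribʳ-+ x (f 0) _) (cong (f 0 * x +_) (∑-* x (f ∘ suc) n))

∑-swap : ∀ (f : ℕ → ℕ → ℕ) m n →
         sum (applyUpTo (λ i → sum (applyUpTo (f i) n)) m) ≡
         sum (applyUpTo (λ j → sum (applyUpTo (λ i → f i j) m)) n)
∑-swap f zero    n = sym (∑-zero n)
∑-swap f (suc m) n = trans (cong (sum (applyUpTo (f 0) n) +_) (∑-swap (f ∘ suc) m n))
  (sym (∑-+ (f 0) (λ j → sum (applyUpTo (λ i → f (suc i) j) m)) n))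

∑-last : ∀ (f : ℕ → ℕ) n → sum (applyUpTo f (suc n)) ≡ sum (applyUpTo f n) + f n
∑-last f zero    = +-identityʳ (f 0)
∑-last f (suc n) = trans (cong (f 0 +_) (∑-last (f ∘ suc) n)) (sym (+-assoc (f 0) _ _))

binomialSum : ℕ → (ℕ → ℕ → ℕ) → ℕ
binomialSum N h = ∑[ k ∈ 0 ⋯ N ] (N C k) * h k (N ∸ k)

binomialSum-cong : ∀ {h h′ : ℕ → ℕ → ℕ} N → (∀ k l → h k l ≡ h′ k l) →
                   binomialSum N h ≡ binomialSum N h′
binomialSum-cong N h≗h′ = ∑-cong (suc N) (λ {k} _ → cong ((N C k) *_) (h≗h′ k (N ∸ k)))

-- Pascal's rule: one of the `N + 1` elements either belongs to the chosen `k`, which raises the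
-- first argument of `h`, or to the others, which raises the second.
binomialSum-suc : ∀ N (h : ℕ → ℕ → ℕ) →
  binomialSum (suc N) h ≡ binomialSum N (λ k l → h (suc k) l) + binomialSum N (λ k l → h k (suc l))
binomialSum-suc N h = begin
  term 0 + sum (applyUpTo (λ k → (suc N C suc k) * h (suc k) (N ∸ k)) (suc N))
    ≡⟨ cong (term 0 +_) (∑-cong (suc N) λ {k} _ → trans
         (cong (_* h (suc k) (N ∸ k)) (sym (nCk+nC[k+1]≡[n+1]C[k+1] N k)))
         (*-distribʳ-+ (h (suc k) (N ∸ k)) (N C k) _)) ⟩
  term 0 + sum (applyUpTo (λ k → (N C k) * h (suc k) (N ∸ k) + term (suc k)) (suc N))
    ≡⟨ cong (term 0 +_) (∑-+ (λ k → (N C k) * h (suc k) (N ∸ k)) (term ∘ suc) (suc N)) ⟩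
  term 0 + (binomialSum N (λ k l → h (suc k) l) + sum (applyUpTo (term ∘ suc) (suc N)))
    ≡⟨ x∙yz≈y∙xz (term 0) (binomialSum N (λ k l → h (suc k) l)) _ ⟩
  binomialSum N (λ k l → h (suc k) l) + sum (applyUpTo term (suc (suc N)))
    ≡⟨ cong (binomialSum N (λ k l → h (suc k) l) +_) shorten ⟩
  binomialSum N (λ k l → h (suc k) l) + binomialSum N (λ k l → h k (suc l)) ∎
  where
  open ≡-Reasoning
  open CommutativeSemigroupProperties +-commutativeSemigroup using (x∙yz≈y∙xz)

  term : ℕ → ℕ
  term k = (N C k) * h k (suc N ∸ k)

  -- The term at `N + 1` carries the factor `N C (N + 1) = 0`. In the remaining terms `k ≤ N`, so
  -- the truncated subtraction commutes with `suc`.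
  shorten : sum (applyUpTo term (suc (suc N))) ≡ binomialSum N (λ k l → h k (suc l))
  shorten = begin
    sum (applyUpTo term (suc (suc N)))      ≡⟨ ∑-last term (suc N) ⟩
    sum (applyUpTo term (suc N)) + term (suc N)
      ≡⟨ cong (λ x → sum (applyUpTo term (suc N)) + x * h (suc N) (N ∸ N)) (k>n⇒nCk≡0 (n<1+n N)) ⟩
    sum (applyUpTo term (suc N)) + 0        ≡⟨ +-identityʳ _ ⟩
    sum (applyUpTo term (suc N))
      ≡⟨ ∑-cong (suc N) (λ {k} k≤N → cong (λ l → (N C k) * h k l) (+-∸-assoc 1 (s≤s⁻¹ k≤N))) ⟩
    binomialSum N (λ k l → h k (suc l))     ∎

-- Bijections of setoids and counting by cases.

-- Surjectivity supplies a chosen preimage for each element; the choice need not respect the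
-- equivalence by itself, but reflection forces it to.
reflecting⇒inverse : (S : Setoid a ℓ₁) (T : Setoid b ℓ₂) →
  let module S = Setoid S; module T = Setoid T in
  (from : T.Carrier → S.Carrier) →
  (∀ {x y} → x T.≈ y → from x S.≈ from y) →
  (∀ {x y} → from x S.≈ from y → x T.≈ y) →
  (∀ s → ∃ λ t → from t S.≈ s) → Inverse S T
reflecting⇒inverse S T from from-cong reflects surjective = record
  { to        = proj₁ ∘ surjective
  ; from      = from
  ; to-cong   = λ s≈s′ → reflects (S.trans (section _) (S.trans s≈s′ (S.sym (section _))))
  ; from-cong = from-cong
  ; inverse   = (λ s≈t → reflects (S.trans (section _) s≈t)) ,
                (λ t≈s → S.trans (from-cong t≈s) (section _))
  }
  where
  module S = Setoid S
  module T = Setoid T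
  section : ∀ s → from (proj₁ (surjective s)) S.≈ s
  section = proj₂ ∘ surjective

Fin-∑↔Σ : ∀ (f : ℕ → ℕ) {I : ℕ → Set} → (∀ i → Fin (f i) ↔ I i) → ∀ n →
          Fin (sum (applyUpTo f n)) ↔ Σ (Fin n) (I ∘ toℕ)
Fin-∑↔Σ f count zero    = mk↔ₛ′ (λ ()) (λ ()) (λ ()) (λ ())
Fin-∑↔Σ f count (suc n) = (+↔⊎ then (count 0 ⊎-↔ Fin-∑↔Σ (f ∘ suc) (count ∘ suc) n)) then mk↔ₛ′
  (λ { (inj₁ x) → zero , x ; (inj₂ (i , x)) → suc i , x })
  (λ { (zero , x) → inj₁ x ; (suc i , x) → inj₂ (i , x) })
  (λ { (zero , x) → refl ; (suc i , x) → refl })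
  (λ { (inj₁ x) → refl ; (inj₂ (i , x)) → refl })

-- The injectivity hypothesis compares dependent pairs: it says at once that different families are
-- disjoint and that each family is irredundant.
cardinality-∑ : (S : Setoid a ℓ₁) (f : ℕ → ℕ) {I : ℕ → Set} (count : ∀ i → Fin (f i) ↔ I i)
  (n : ℕ) → let open Setoid S in
  (from : ∀ i → .(i < n) → I i → Carrier) →
  (∀ {i j} .(i<n : i < n) .(j<n : j < n) x y →
    from i i<n x ≈ from j j<n y → _≡_ {A = ∃ I} (i , x) (j , y)) →
  (∀ s → ∃ λ i → Σ (i < n) λ i<n → ∃ λ x → from i i<n x ≈ s) →
  HasCardinality S (sum (applyUpTo f n))
cardinality-∑ S f {I} count n from injective surjective =
  reflecting⇒inverse S (setoid _) (λ (i , x) → from (toℕ i) (toℕ<n i) x)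
    (λ { refl → Setoid.refl S })
    (λ {(i , x)} {(j , y)} eq →
      let eq′ = injective (toℕ<n i) (toℕ<n j) x y eq in lift (toℕ-injective (cong proj₁ eq′)) eq′)
    (λ s → let i , i<n , x , eq = surjective s in lower (toℕ-fromℕ< i<n) i<n x eq)
    then flip (Fin-∑↔Σ f count n)
  where
  open Setoid S using (_≈_)

  lift : ∀ {i j : Fin n} {x : I (toℕ i)} {y : I (toℕ j)} → i ≡ j →
         _≡_ {A = ∃ I} (toℕ i , x) (toℕ j , y) → _≡_ {A = Σ (Fin n) (I ∘ toℕ)} (i , x) (j , y)
  lift refl eq = cong (_ ,_) (Product.,-injectiveʳ-≡ ≡-irrelevant eq refl)

  lower : ∀ {i s} {j : Fin n} → toℕ j ≡ i → .(i<n : i < n) (x : I i) → from i i<n x ≈ s →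
          ∃ λ ((j , y) : Σ (Fin n) (I ∘ toℕ)) → from (toℕ j) (toℕ<n j) y ≈ s
  lower {j = j} refl i<n x eq = (j , x) , eq

-- Kernels of maps between finite sets.

-- A kernel is represented by any map that has it; `B` serves only to bound the number of classes.
Kernels : Set → Set → Setoid 0ℓ 0ℓ
Kernels A B = record
  { Carrier       = A → B
  ; _≈_           = λ f g → f ≲ g × g ≲ f
  ; isEquivalence = record
    { refl  = (λ _ _ → id) , (λ _ _ → id)
    ; sym   = λ (f≲g , g≲f) → g≲f , f≲g
    ; trans = λ (f≲g , g≲f) (g≲h , h≲g) →
        (λ i j → g≲h i j ∘ f≲g i j) , (λ i j → g≲f i j ∘ h≲g i j)
    }
  }

-- An equality between values of `f` is carried forward by `φ`, whereas one between values of `g`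
-- has to be recovered through `ψ`, hence the injectivity of `ψ`.
≲-reindex : ∀ {A B C A′ B′ C′ : Set} {f : A → B} {g : A → C} {f′ : A′ → B′} {g′ : A′ → C′}
            (ρ : A → A′) (φ : B → B′) (ψ : C → C′) → (∀ {x y} → ψ x ≡ ψ y → x ≡ y) →
            (∀ i → f′ (ρ i) ≡ φ (f i)) → (∀ i → g′ (ρ i) ≡ ψ (g i)) → f′ ≲ g′ → f ≲ g
≲-reindex ρ φ ψ ψ-injective f′≗f g′≗g f′≲g′ i j eq = ψ-injective (trans (sym (g′≗g i)) (trans
  (f′≲g′ (ρ i) (ρ j) (trans (f′≗f i) (trans (cong φ eq) (sym (f′≗f j))))) (g′≗g j)))

partitionsInto : ∀ p q → Enumeration (Fin (S p q)) p q
partitionsInto p q = cardinality⇒enumeration (proj₂ (partitions-finite p q))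

open Partition using (label)
open Enumeration

partition : ∀ p q → Fin (S p q) → Partition (Fin p) q
partition p q = part (partitionsInto p q)

representative : ∀ {A : Set} (P : Partition A q) → Fin q → A
representative P = proj₁ ∘ onto P

label-representative : ∀ {A : Set} (P : Partition A q) k → label P (representative P k) ≡ k
label-representative P = proj₂ ∘ onto P

representative-injective : ∀ {A : Set} (P : Partition A q) {k l} →
                           representative P k ≡ representative P l → k ≡ l
representative-injective P {k} {l} eq = trans (sym (label-representative P k))
  (trans (cong (label P) eq) (label-representative P l))

blocks≤ : Partition (Fin p) q → q ≤ p
blocks≤ P = injective⇒≤ (representative-injective P)

-- Representatives of different blocks of `P` lie in different blocks of the finer partition `Q`.
same-kernel⇒blocks≤ : (P : Partition (Fin p) m) (Q : Partition (Fin p) n) →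
                      label Q ≲ label P → m ≤ n
same-kernel⇒blocks≤ P Q Q≲P = injective⇒≤ {f = label Q ∘ representative P}
  (λ {k} {l} eq → trans (sym (label-representative P k))
    (trans (Q≲P _ _ eq) (label-representative P l)))

-- The values that are not taken are removed one at a time.
kernelPartition : ∀ n (f : Fin p → Fin n) →
  ∃ λ q → q ≤ n × Σ (Partition (Fin p) q) λ P → label P ≲ f × f ≲ label P
kernelPartition zero    f = 0 , z≤n , fibres f (λ ()) , (λ _ _ → id) , (λ _ _ → id)
kernelPartition (suc n) f with all? (λ k → any? (λ i → f i Fin.≟ k))
... | yes f-onto = suc n , ≤-refl , fibres f f-onto , (λ _ _ → id) , (λ _ _ → id)
... | no ¬onto with ¬∀⟶∃¬ _ _ (λ k → any? (λ i → f i Fin.≟ k)) ¬onto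
... | k , unhit =
  let q , q≤n , P , P≲f , f≲P = kernelPartition n (λ i → punchOut (k≢f i))
  in q , m≤n⇒m≤1+n q≤n , P ,
     (λ i j → punchOut-injective (k≢f i) (k≢f j) ∘ P≲f i j) ,
     (λ i j → f≲P i j ∘ punchOut-cong k)
  where
  k≢f : ∀ i → k ≢ f i
  k≢f i eq = unhit (i , sym eq)

same-kernel⇒≡ : ∀ {i j} (x : Fin (S p i)) (y : Fin (S p j)) →
                label (partition p i x) ≲ label (partition p j y) →
                label (partition p j y) ≲ label (partition p i x) →
                _≡_ {A = ∃ (Fin ∘ S p)} (i , x) (j , y)
same-kernel⇒≡ {p} {i} {j} x y x≲y y≲x with refl ← ≤-antisym
    (same-kernel⇒blocks≤ (partition p i x) (partition p j y) y≲x)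
    (same-kernel⇒blocks≤ (partition p j y) (partition p i x) x≲y)
  = cong (_ ,_) (inj (partitionsInto p i) x y x≲y y≲x)

-- A kernel with `c` classes is realised by its labelling, read in `Fin n` through the inclusion of
-- `Fin c`; this is possible exactly for `c ≤ n`.
kernels-cardinality : ∀ n p .{{_ : NonZero p}} →
                      HasCardinality (Kernels (Fin p) (Fin n)) (∑[ c ∈ 1 ⋯ n ] S p c)
kernels-cardinality n p@(suc _) = cardinality-∑
  (Kernels (Fin p) (Fin n)) (S p ∘ suc) (λ _ → ↔-id _) n from injective surjective
  where
  from : ∀ c → .(c < n) → Fin (S p (suc c)) → Fin p → Fin n
  from c c<n x j = inject≤ (label (partition p (suc c) x) j) c<n

  injective : ∀ {c d} .(c<n : c < n) .(d<n : d < n) x y →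
              from c c<n x ≲ from d d<n y × from d d<n y ≲ from c c<n x →
              _≡_ {A = ∃ (Fin ∘ S p ∘ suc)} (c , x) (d , y)
  injective c<n d<n x y (x≲y , y≲x) with refl ← same-kernel⇒≡ x y
    (λ k l eq → inject≤-injective _ d<n _ _ (x≲y k l (cong (λ z → inject≤ z c<n) eq)))
    (λ k l eq → inject≤-injective _ c<n _ _ (y≲x k l (cong (λ z → inject≤ z d<n) eq)))
    = refl

  surjective : ∀ f → ∃ λ c → Σ (c < n) λ c<n → ∃ λ x → from c c<n x ≲ f × f ≲ from c c<n x
  surjective f with kernelPartition n f
  -- Here `p` is a successor, so there is at least one block; the sum can start at `c = 1`.
  ... | zero  , _   , P , _ = contradiction (label P zero) λ ()
  ... | suc c , c<n , P , P≲f , f≲P = c , c<n , code (partitionsInto p (suc c)) P ,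
    (λ i j → P≲f i j ∘ ≲P (partitionsInto p (suc c)) P i j ∘ inject≤-injective _ c<n _ _) ,
    (λ i j → cong (λ z → inject≤ z c<n) ∘ P≲ (partitionsInto p (suc c)) P i j ∘ f≲P i j)

-- Signs and equivariant maps between free orbits.

xor-cancelʳ : ∀ {b c} d → b xor d ≡ c xor d → b ≡ c
xor-cancelʳ {b} {c} d eq = trans (sym (cancel b)) (trans (cong (_xor d) eq) (cancel c))
  where
  cancel : ∀ b → (b xor d) xor d ≡ b
  cancel b = trans (xor-assoc b d d) (trans (cong (b xor_) (xor-same d)) (xor-identityʳ b))

funToFin-cong : {f g : Fin m → Fin n} → f ≗ g → funToFin f ≡ funToFin g
funToFin-cong {zero}  f≗g = refl
funToFin-cong {suc m} f≗g = cong₂ combine (f≗g zero) (funToFin-cong (f≗g ∘ suc))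

insertAt-cong : ∀ {A : Set a} {f g : Fin n → A} → f ≗ g → ∀ i x → insertAt f i x ≗ insertAt g i x
insertAt-cong             f≗g zero    x zero    = refl
insertAt-cong             f≗g zero    x (suc j) = f≗g j
insertAt-cong {n = suc n} f≗g (suc i) x zero    = f≗g zero
insertAt-cong {n = suc n} f≗g (suc i) x (suc j) = insertAt-cong (f≗g ∘ suc) i x j

-- Flipping all signs on one block leaves the kernel of a signed map unchanged. Demanding the sign
-- `false` at the representatives `r` selects one sign function from each class.
NormalisedSigns : (Fin q → Fin p) → Setoid 0ℓ 0ℓ
NormalisedSigns {q} {p} r =
  On.setoid {B = Σ (Fin p → Bool) λ σ → ∀ k → σ (r k) ≡ false} (Fin p →-setoid Bool) proj₁

-- The sign at `r zero` is prescribed, so this position can be deleted; by injectivity of `r` the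
-- other representatives survive. Once no representatives are left, all sign functions on the
-- remaining positions are allowed.
normalisedSigns-cardinality : ∀ q p (r : Fin q → Fin p) → (∀ {k l} → r k ≡ r l → k ≡ l) →
                              HasCardinality (NormalisedSigns r) (2 ^ (p ∸ q))
normalisedSigns-cardinality zero p r r-injective = reflecting⇒inverse (NormalisedSigns r) (setoid _)
  (λ x → Inverse.to 2↔Bool ∘ finToFun {2} {p} x , λ ())
  (λ { refl _ → refl })
  (λ {x} {y} eq → trans (sym (funToFin-finToFin {p} x)) (trans
    (funToFin-cong (Injection.injective (↔⇒↣ 2↔Bool) ∘ eq)) (funToFin-finToFin {p} y)))
  (λ (σ , _) → funToFin (Inverse.from 2↔Bool ∘ σ) , λ i →
    trans (cong (Inverse.to 2↔Bool) (finToFun-funToFin (Inverse.from 2↔Bool ∘ σ) i))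
          (Inverse.strictlyInverseˡ 2↔Bool (σ i)))
normalisedSigns-cardinality (suc q) zero    r r-injective = contradiction (r zero) λ ()
normalisedSigns-cardinality (suc q) (suc p) r r-injective =
  reflecting⇒inverse (NormalisedSigns r) (NormalisedSigns r′)
    (λ (σ , normal) → insertAt σ r₀ false , λ
      { zero    → insertAt-lookup σ r₀ false
      ; (suc k) → trans (cong (insertAt σ r₀ false) (sym (punchIn-punchOut (r₀≢ k))))
                    (trans (insertAt-punchIn σ r₀ false (r′ k)) (normal k)) })
    (λ σ≗τ → insertAt-cong σ≗τ r₀ false)
    (λ {(σ , _)} {(τ , _)} eq k → trans (sym (insertAt-punchIn σ r₀ false k))
      (trans (eq (punchIn r₀ k)) (insertAt-punchIn τ r₀ false k)))
    (λ (τ , normal) →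
      (removeAt τ r₀ , λ k → trans (cong τ (punchIn-punchOut (r₀≢ k))) (normal (suc k))) ,
      λ j → trans (cong (λ b → insertAt (removeAt τ r₀) r₀ b j) (sym (normal zero)))
                  (insertAt-removeAt τ r₀ j))
    then normalisedSigns-cardinality q p r′
      (λ {k} {l} eq → Fin.suc-injective (r-injective (punchOut-injective (r₀≢ k) (r₀≢ l) eq)))
  where
  r₀ = r zero

  r₀≢ : ∀ k → r₀ ≢ r (suc k)
  r₀≢ k eq with () ← r-injective eq

  r′ : Fin q → Fin p
  r′ k = punchOut (r₀≢ k)

module _ {A B : Set} where

  -- The equivariant map between free `Bool`-sets that sends `(false , x)` to `w x`.
  signedMap : (A → B × Bool) → Bool × A → B × Bool
  signedMap w (b , x) = proj₁ (w x) , b xor proj₂ (w x)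

  SignedKernels : Setoid 0ℓ 0ℓ
  SignedKernels = On.setoid (Kernels (Bool × A) (B × Bool)) signedMap

signed : (P : Partition (Fin p) m) → (Fin p → Bool) → .(m ≤ n) → Fin p → Fin n × Bool
signed P σ m≤n x = inject≤ (label P x) m≤n , σ x

-- Pairing each `x` with its own sign `σ x` makes the sign of its image `false`, so that points with
-- equal labels have equal images.
signed-≲ : ∀ {m m′} (P : Partition (Fin p) m) (Q : Partition (Fin p) m′) (σ τ : Fin p → Bool)
           .(m≤n : m ≤ n) .(m′≤n : m′ ≤ n) →
           signedMap (signed P σ m≤n) ≲ signedMap (signed Q τ m′≤n) → label P ≲ label Q
signed-≲ P Q σ τ m≤n m′≤n P≲Q x y eq = inject≤-injective _ m′≤n _ _ (cong proj₁
  (P≲Q (σ x , x) (σ y , y)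
    (cong₂ _,_ (cong (λ z → inject≤ z m≤n) eq) (trans (xor-same (σ x)) (sym (xor-same (σ y)))))))

-- With the signs `σ`, the points `(σ x , x)` and `(false , r)` have the same image, `r` being the
-- representative of the block of `x`. With the signs `τ` they therefore do too, which reads
-- `σ x xor τ x ≡ false`.
signed-≗ : (P : Partition (Fin p) m) .(m≤n : m ≤ n)
           ((σ , _) (τ , _) : Setoid.Carrier (NormalisedSigns (representative P))) →
           signedMap (signed P σ m≤n) ≲ signedMap (signed P τ m≤n) → σ ≗ τ
signed-≗ P m≤n (σ , σ-normal) (τ , τ-normal) σ≲τ x =
  xor-cancelʳ (τ x) (trans (cong proj₂ (σ≲τ (σ x , x) (false , r)
    (cong₂ _,_ (cong (λ z → inject≤ z m≤n) (sym (label-representative P (label P x))))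
      (trans (xor-same (σ x)) (sym (σ-normal (label P x)))))))
    (trans (τ-normal (label P x)) (sym (xor-same (τ x)))))
  where
  r = representative P (label P x)

-- A kernel amounts to a partition of the `j` orbits together with normalised signs. As `j ≤ M`,
-- there are enough target orbits for every such partition.
signedKernels-cardinality : ∀ j M → j ≤ M →
  HasCardinality (SignedKernels {Fin j} {Fin M}) (∑[ m ∈ 0 ⋯ j ] S j m * 2 ^ (j ∸ m))
signedKernels-cardinality j M j≤M = cardinality-∑ SignedKernels (λ m → S j m * 2 ^ (j ∸ m))
  (λ m → *↔×) (suc j) from injective surjective
  where
  signs↔ : ∀ {m} (P : Partition (Fin j) m) →
           HasCardinality (NormalisedSigns (representative P)) (2 ^ (j ∸ m))
  signs↔ {m} P = normalisedSigns-cardinality m j (representative P) (representative-injective P)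

  signs : ∀ {m} (P : Partition (Fin j) m) → Fin (2 ^ (j ∸ m)) → Fin j → Bool
  signs P z = proj₁ (Inverse.from (signs↔ P) z)

  bound : ∀ {m} → m < suc j → m ≤ M
  bound m≤j = ≤-trans (s≤s⁻¹ m≤j) j≤M

  from : ∀ m → .(m < suc j) → Fin (S j m) × Fin (2 ^ (j ∸ m)) → Fin j → Fin M × Bool
  from m m≤j (y , z) = let P = partition j m y in signed P (signs P z) (bound m≤j)

  injective : ∀ {k l} .(k≤j : k < suc j) .(l≤j : l < suc j) x y →
    signedMap (from k k≤j x) ≲ signedMap (from l l≤j y) ×
    signedMap (from l l≤j y) ≲ signedMap (from k k≤j x) →
    _≡_ {A = ∃ λ m → Fin (S j m) × Fin (2 ^ (j ∸ m))} (k , x) (l , y)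
  injective {k} {l} k≤j l≤j (x , z) (y , z′) (x≲y , y≲x)
    with refl ← same-kernel⇒≡ x y
      (signed-≲ (partition j k x) (partition j l y) _ _ (bound k≤j) (bound l≤j) x≲y)
      (signed-≲ (partition j l y) (partition j k x) _ _ (bound l≤j) (bound k≤j) y≲x)
    = cong (λ z → k , x , z) (trans (sym (strictlyInverseˡ z)) (trans
        (to-cong (signed-≗ P (bound k≤j) (signs-of z) (signs-of z′) x≲y))
        (strictlyInverseˡ z′)))
    where
    P = partition j k x
    open Inverse (signs↔ P) using (to-cong; strictlyInverseˡ) renaming (from to signs-of)

  surjective : ∀ w → ∃ λ m → Σ (m < suc j) λ m≤j → ∃ λ x →
    signedMap (from m m≤j x) ≲ signedMap w × signedMap w ≲ signedMap (from m m≤j x)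
  surjective w with kernelPartition M (proj₁ ∘ w)
  ... | m , m≤M , P , P≲w , w≲P = m , s≤s (blocks≤ P) , (y , z) , ≲w , w≲
    where
    y = code (partitionsInto j m) P
    P′ = partition j m y

    r : Fin m → Fin j
    r = representative P′

    -- The sign of the representative of the block of `x`. Adding it normalises the signs, and being
    -- constant on blocks it does not change the kernel.
    shift : Fin j → Bool
    shift x = proj₂ (w (r (label P′ x)))

    σ : Fin j → Bool
    σ x = proj₂ (w x) xor shift x

    normal : ∀ k → σ (r k) ≡ false
    normal k = trans (cong (λ l → proj₂ (w (r k)) xor proj₂ (w (r l)))
      (label-representative P′ k)) (xor-same (proj₂ (w (r k))))

    z = Inverse.to (signs↔ P′) (σ , normal)

    signs-z : ∀ b x → b xor signs P′ z x ≡ (b xor proj₂ (w x)) xor shift x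
    signs-z b x = trans (cong (b xor_) (Inverse.strictlyInverseʳ (signs↔ P′) (σ , normal) x))
      (sym (xor-assoc b (proj₂ (w x)) (shift x)))

    shift-cong : ∀ {x y} → label P′ x ≡ label P′ y → shift x ≡ shift y
    shift-cong = cong (λ l → proj₂ (w (r l)))

    ≲w : signedMap (from m (s≤s (blocks≤ P)) (y , z)) ≲ signedMap w
    ≲w (b , x) (c , y) eq = cong₂ _,_ (P≲w x y (≲P (partitionsInto j m) P x y same))
      (xor-cancelʳ (shift x) (trans (sym (signs-z b x)) (trans (cong proj₂ eq)
        (trans (signs-z c y) (cong ((c xor proj₂ (w y)) xor_) (sym (shift-cong same)))))))
      where
      same = inject≤-injective _ (≤-trans (blocks≤ P) j≤M) _ _ (cong proj₁ eq)

    w≲ : signedMap w ≲ signedMap (from m (s≤s (blocks≤ P)) (y , z))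
    w≲ (b , x) (c , y) eq = cong₂ _,_ (cong (λ l → inject≤ l (≤-trans (blocks≤ P) j≤M)) same)
      (trans (signs-z b x) (trans (cong₂ _xor_ (cong proj₂ eq) (shift-cong same))
        (sym (signs-z c y))))
      where
      same = P≲ (partitionsInto j m) P x y (w≲P x y (cong proj₁ eq))

-- Sets with an action of the two-element group.

-- A Bool-set with fixed points F and free orbits O.
Points : Set → Set → Set
Points F O = F ⊎ (O × Bool)

module _ {F O : Set} where

  infixr 7 _·_
  _·_ : Bool → Points F O → Points F O
  b · inj₁ x       = inj₁ x
  b · inj₂ (o , s) = inj₂ (o , b xor s)

  ·-assoc : ∀ b c z → (b xor c) · z ≡ b · c · z
  ·-assoc b c (inj₁ x)       = refl
  ·-assoc b c (inj₂ (o , s)) = cong (λ t → inj₂ (o , t)) (xor-assoc b c s)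

  false-· : ∀ z → false · z ≡ z
  false-· (inj₁ x) = refl
  false-· (inj₂ y) = refl

  fixed : ∀ z → true · z ≡ z → ∃ λ x → z ≡ inj₁ x
  fixed (inj₁ x)       eq = x , refl
  fixed (inj₂ (o , s)) eq = contradiction (sym (cong proj₂ (Sum.inj₂-injective eq))) (not-¬ refl)

  -- The equivariant extension of `t` to the free `Bool`-set over `A`. Where `t` takes a fixed point
  -- as its value, the two copies of the argument are identified.
  extend : ∀ {A : Set} → (A → Points F O) → Bool × A → Points F O
  extend t (b , x) = b · t x

  extend-reindex : ∀ {A A′ : Set} {s t : A → Points F O} {s′ t′ : A′ → Points F O} (ρ : A → A′) →
                   s′ ∘ ρ ≗ s → t′ ∘ ρ ≗ t → extend s′ ≲ extend t′ → extend s ≲ extend t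
  extend-reindex ρ s′≗s t′≗t = ≲-reindex (λ (b , x) → b , ρ x) id id id
    (λ (b , x) → cong (b ·_) (s′≗s x)) (λ (b , x) → cong (b ·_) (t′≗t x))

-- Kernels of equivariant maps, counted by deciding one orbit at a time.

module Quotients (n M : ℕ) where

  Point : Set
  Point = Points (Fin n) (Fin M)

  Index : ℕ → ℕ → ℕ → Set
  Index p N j = Fin p ⊎ Fin N ⊎ Fin j

  -- An equivariant map on p fixed points, N free orbits with arbitrary images and
  -- j free orbits with free images.
  Assignment : ℕ → ℕ → ℕ → Set
  Assignment p N j = (Fin p → Fin n) × (Fin N → Point) × (Fin j → Fin M × Bool)

  values : ∀ {p N j} → Assignment p N j → Index p N j → Point
  values (d , u , w) = [ inj₁ ∘ d , [ u , inj₂ ∘ w ] ]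

  -- The `p` fixed points also occur in two copies here. Their values are fixed points, so the
  -- copies are always identified and the doubling adds no information.
  Quotients : ℕ → ℕ → ℕ → Setoid 0ℓ 0ℓ
  Quotients p N j = On.setoid (Kernels (Bool × Index p N j) Point) (extend ∘ values)

  -- When no orbit is undecided, every value is known in advance to be a fixed point or to lie in a
  -- free orbit. No identification crosses between the two sorts, and the kernel splits into
  -- independent parts.
  decided : ∀ p j →
            Inverse (Quotients p 0 j) (Kernels (Fin p) (Fin n) ×ₛ SignedKernels {Fin j} {Fin M})
  decided p j = reflecting⇒inverse (Quotients p 0 j) (Kernels (Fin p) (Fin n) ×ₛ SignedKernels)
    (λ (d , w) → d , (λ ()) , w)
    (λ ((d≲d′ , d′≲d) , (w≲w′ , w′≲w)) → jointly d≲d′ w≲w′ , jointly d′≲d w′≲w)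
    (λ (≲′ , ≳′) → (onFixed ≲′ , onFixed ≳′) , (onFree ≲′ , onFree ≳′))
    (λ (d , u , w) → (d , w) ,
       extend-reindex id (same d u w) (λ _ → refl) (λ _ _ → id) ,
       extend-reindex id (λ _ → refl) (same d u w) (λ _ _ → id))
    where
    same : ∀ d (u : Fin 0 → Point) (w : Fin j → Fin M × Bool) →
           values {p} (d , u , w) ≗ values (d , (λ ()) , w)
    same d u w (inj₁ x)        = refl
    same d u w (inj₂ (inj₂ x)) = refl

    jointly : ∀ {d d′ : Fin p → Fin n} {w w′ : Fin j → Fin M × Bool} →
              d ≲ d′ → signedMap w ≲ signedMap w′ →
              extend (values (d , (λ ()) , w)) ≲ extend (values (d′ , (λ ()) , w′))
    jointly d≲ w≲ (b , inj₁ x)         (c , inj₁ y)         eq =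
      cong inj₁ (d≲ x y (Sum.inj₁-injective eq))
    jointly d≲ w≲ (b , inj₂ (inj₁ ())) _                    eq
    jointly d≲ w≲ (b , inj₁ x)         (c , inj₂ (inj₁ ())) eq
    jointly d≲ w≲ (b , inj₂ (inj₂ x))  (c , inj₂ (inj₁ ())) eq
    jointly d≲ w≲ (b , inj₁ x)         (c , inj₂ (inj₂ y))  ()
    jointly d≲ w≲ (b , inj₂ (inj₂ x))  (c , inj₁ y)         ()
    jointly d≲ w≲ (b , inj₂ (inj₂ x))  (c , inj₂ (inj₂ y))  eq =
      cong inj₂ (w≲ (b , x) (c , y) (Sum.inj₂-injective eq))

    onFixed : ∀ {d d′ : Fin p → Fin n} {w w′ : Fin j → Fin M × Bool} →
              extend (values (d , (λ ()) , w)) ≲ extend (values (d′ , (λ ()) , w′)) → d ≲ d′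
    onFixed = ≲-reindex (λ x → false , inj₁ x) inj₁ inj₁ Sum.inj₁-injective
      (λ _ → refl) (λ _ → refl)

    onFree : ∀ {d d′ : Fin p → Fin n} {w w′ : Fin j → Fin M × Bool} →
             extend (values (d , (λ ()) , w)) ≲ extend (values (d′ , (λ ()) , w′)) →
             signedMap w ≲ signedMap w′
    onFree = ≲-reindex (λ (b , x) → b , inj₂ (inj₂ x)) inj₂ inj₂ Sum.inj₂-injective
      (λ _ → refl) (λ _ → refl)

  module Decide (p N j : ℕ) where

    -- Read backwards, this settles the first undecided orbit: if its image is a fixed point, it
    -- joins the `p` fixed points, and otherwise the `j` orbits with free images.
    decide : Assignment (suc p) N j ⊎ Assignment p N (suc j) → Assignment p (suc N) j
    decide (inj₁ (d , u , w)) = d ∘ suc , inj₁ (d zero) ∷ u , w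
    decide (inj₂ (d , u , w)) = d , inj₂ (w zero) ∷ u , w ∘ suc

    -- This and the next three maps follow the orbit being decided to its new place. Values are
    -- preserved along them, so kernel inclusions can be pulled back in either direction.
    toFixed : Index (suc p) N j → Index p (suc N) j
    toFixed (inj₁ zero)     = inj₂ (inj₁ zero)
    toFixed (inj₁ (suc x))  = inj₁ x
    toFixed (inj₂ (inj₁ x)) = inj₂ (inj₁ (suc x))
    toFixed (inj₂ (inj₂ x)) = inj₂ (inj₂ x)

    fromFixed : Index p (suc N) j → Index (suc p) N j
    fromFixed (inj₁ x)              = inj₁ (suc x)
    fromFixed (inj₂ (inj₁ zero))    = inj₁ zero
    fromFixed (inj₂ (inj₁ (suc x))) = inj₂ (inj₁ x)
    fromFixed (inj₂ (inj₂ x))       = inj₂ (inj₂ x)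

    toFree : Index p N (suc j) → Index p (suc N) j
    toFree (inj₁ x)              = inj₁ x
    toFree (inj₂ (inj₁ x))       = inj₂ (inj₁ (suc x))
    toFree (inj₂ (inj₂ zero))    = inj₂ (inj₁ zero)
    toFree (inj₂ (inj₂ (suc x))) = inj₂ (inj₂ x)

    fromFree : Index p (suc N) j → Index p N (suc j)
    fromFree (inj₁ x)              = inj₁ x
    fromFree (inj₂ (inj₁ zero))    = inj₂ (inj₂ zero)
    fromFree (inj₂ (inj₁ (suc x))) = inj₂ (inj₁ x)
    fromFree (inj₂ (inj₂ x))       = inj₂ (inj₂ (suc x))

    values-toFixed : ∀ t → values (decide (inj₁ t)) ∘ toFixed ≗ values t
    values-toFixed t (inj₁ zero)     = refl
    values-toFixed t (inj₁ (suc x))  = refl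
    values-toFixed t (inj₂ (inj₁ x)) = refl
    values-toFixed t (inj₂ (inj₂ x)) = refl

    values-fromFixed : ∀ t → values t ∘ fromFixed ≗ values (decide (inj₁ t))
    values-fromFixed t (inj₁ x)              = refl
    values-fromFixed t (inj₂ (inj₁ zero))    = refl
    values-fromFixed t (inj₂ (inj₁ (suc x))) = refl
    values-fromFixed t (inj₂ (inj₂ x))       = refl

    values-toFree : ∀ t → values (decide (inj₂ t)) ∘ toFree ≗ values t
    values-toFree t (inj₁ x)              = refl
    values-toFree t (inj₂ (inj₁ x))       = refl
    values-toFree t (inj₂ (inj₂ zero))    = refl
    values-toFree t (inj₂ (inj₂ (suc x))) = refl

    values-fromFree : ∀ t → values t ∘ fromFree ≗ values (decide (inj₂ t))
    values-fromFree t (inj₁ x)              = refl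
    values-fromFree t (inj₂ (inj₁ zero))    = refl
    values-fromFree t (inj₂ (inj₁ (suc x))) = refl
    values-fromFree t (inj₂ (inj₂ x))       = refl

    Decided : Setoid 0ℓ 0ℓ
    Decided = Quotients (suc p) N j ⊎ₛ Quotients p N (suc j)

    open Setoid Decided using (_≈_)
    open Setoid (Quotients p (suc N) j) using () renaming (_≈_ to _≈′_)

    decide-cong : ∀ {s t} → s ≈ t → decide s ≈′ decide t
    decide-cong (inj₁ {s} {t} (s≲t , t≲s)) =
      extend-reindex fromFixed (values-fromFixed s) (values-fromFixed t) s≲t ,
      extend-reindex fromFixed (values-fromFixed t) (values-fromFixed s) t≲s
    decide-cong (inj₂ {s} {t} (s≲t , t≲s)) =
      extend-reindex fromFree (values-fromFree s) (values-fromFree t) s≲t ,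
      extend-reindex fromFree (values-fromFree t) (values-fromFree s) t≲s

    -- The undecided orbit is mapped to a fixed point iff its two elements are identified.
    decide-disjoint : ∀ s t →
      ¬ (extend (values (decide (inj₁ s))) ≲ extend (values (decide (inj₂ t))))
    decide-disjoint s t s≲t
      with () ← proj₂ (fixed (inj₂ _)
        (trans (s≲t (true , inj₂ (inj₁ zero)) (false , inj₂ (inj₁ zero)) refl) (false-· (inj₂ _))))

    decide-reflects : ∀ {s t} → decide s ≈′ decide t → s ≈ t
    decide-reflects {inj₁ s} {inj₁ t} (s≲t , t≲s) = inj₁
      (extend-reindex toFixed (values-toFixed s) (values-toFixed t) s≲t ,
       extend-reindex toFixed (values-toFixed t) (values-toFixed s) t≲s)
    decide-reflects {inj₁ s} {inj₂ t} (s≲t , _) = contradiction s≲t (decide-disjoint s t)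
    decide-reflects {inj₂ s} {inj₁ t} (_ , t≲s) = contradiction t≲s (decide-disjoint t s)
    decide-reflects {inj₂ s} {inj₂ t} (s≲t , t≲s) = inj₂
      (extend-reindex toFree (values-toFree s) (values-toFree t) s≲t ,
       extend-reindex toFree (values-toFree t) (values-toFree s) t≲s)

    ≗⇒≈ : ∀ {s t : Assignment p (suc N) j} → values s ≗ values t → s ≈′ t
    ≗⇒≈ {s} {t} s≗t = extend-reindex {s = values s} id (sym ∘ s≗t) (λ _ → refl) (λ _ _ → id) ,
                      extend-reindex {s = values t} id (λ _ → refl) (sym ∘ s≗t) (λ _ _ → id)

    decide-surjective : ∀ t → ∃ λ s → decide s ≈′ t
    decide-surjective t@(d , u , w) with u zero in eq
    ... | inj₁ x = s , ≗⇒≈ {decide s} {t} λ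
      { (inj₁ _)              → refl
      ; (inj₂ (inj₁ zero))    → sym eq
      ; (inj₂ (inj₁ (suc _))) → refl
      ; (inj₂ (inj₂ _))       → refl
      }
      where s = inj₁ (x ∷ d , u ∘ suc , w)
    ... | inj₂ y = s , ≗⇒≈ {decide s} {t} λ
      { (inj₁ _)              → refl
      ; (inj₂ (inj₁ zero))    → sym eq
      ; (inj₂ (inj₁ (suc _))) → refl
      ; (inj₂ (inj₂ _))       → refl
      }
      where s = inj₂ (d , u ∘ suc , y ∷ w)

    undecided : Inverse (Quotients p (suc N) j) Decided
    undecided = reflecting⇒inverse (Quotients p (suc N) j) Decided
      decide decide-cong decide-reflects decide-surjective

  -- The factors contributed by the collapsed points and by the free orbits. The term `m = 0` of the
  -- latter is nonzero only for `j = 0`, where it counts the empty map.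
  fixedCount freeCount : ℕ → ℕ
  fixedCount p = ∑[ c ∈ 1 ⋯ n ] S p c
  freeCount  j = ∑[ m ∈ 0 ⋯ j ] S j m * 2 ^ (j ∸ m)

  -- Each decision is one application of Pascal's rule, `k` counting the orbits sent to fixed
  -- points. `N + j` never increases, so at the end the free orbits still number at most `M`.
  quotients-cardinality : ∀ p N j .{{_ : NonZero p}} → N + j ≤ M →
    HasCardinality (Quotients p N j)
      (binomialSum N (λ k l → fixedCount (p + k) * freeCount (l + j)))
  quotients-cardinality p zero j j≤M = subst (HasCardinality (Quotients p 0 j))
    (sym (trans (+-identityʳ _) (trans (+-identityʳ _)
      (cong (λ p → fixedCount p * freeCount j) (+-identityʳ p)))))
    (((decided p j then (kernels-cardinality n p ×-inverse signedKernels-cardinality j M j≤M))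
      then ×ₛ≡↔) then flip *↔×)
  quotients-cardinality p (suc N) j N+j<M = subst (HasCardinality (Quotients p (suc N) j))
    (sym (trans (binomialSum-suc N (λ k l → fixedCount (p + k) * freeCount (l + j))) (cong₂ _+_
      (binomialSum-cong N (λ k l → cong (λ p → fixedCount p * freeCount (l + j)) (+-suc p k)))
      (binomialSum-cong N (λ k l →
        cong (λ j → fixedCount (p + k) * freeCount j) (sym (+-suc l j)))))))
    (((Decide.undecided p N j then
       (quotients-cardinality (suc p) N j (≤-trans (n≤1+n (N + j)) N+j<M) ⊎-inverse
        quotients-cardinality p N (suc j) (≤-trans (≤-reflexive (+-suc N j)) N+j<M)))
      then ⊎ₛ≡↔ _ _) then flip +↔⊎)

-- Pairs of elements as fixed points and free orbits of the interchange.

-- The binomial coefficient `n C 2` in a form that unfolds: the pairs containing `zero` come first,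
-- then the pairs among the other elements.
pairCount : ℕ → ℕ
pairCount zero    = 0
pairCount (suc n) = n + pairCount n

pairCount≡nC2 : ∀ n → pairCount n ≡ n C 2
pairCount≡nC2 zero    = refl
pairCount≡nC2 (suc n) = trans (cong₂ _+_ (sym (nC1≡n n)) (pairCount≡nC2 n))
  (nCk+nC[k+1]≡[n+1]C[k+1] n 1)

PairPoints : ℕ → Set
PairPoints n = Points (Fin n) (Fin (pairCount n))

shift : PairPoints n → PairPoints (suc n)
shift     (inj₁ i)       = inj₁ (suc i)
shift {n} (inj₂ (o , s)) = inj₂ (n ↑ʳ o , s)

-- Diagonal pairs are the fixed points. An off-diagonal pair becomes its unordered pair together
-- with a sign, which is `true` when the first coordinate is the larger.
pack : Fin n → Fin n → PairPoints n
pack         zero    zero    = inj₁ zero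
pack {suc n} zero    (suc j) = inj₂ (j ↑ˡ pairCount n , false)
pack {suc n} (suc i) zero    = inj₂ (i ↑ˡ pairCount n , true)
pack         (suc i) (suc j) = shift (pack i j)

shift-· : ∀ b (z : PairPoints n) → shift (b · z) ≡ b · shift z
shift-· b (inj₁ i) = refl
shift-· b (inj₂ y) = refl

pack-swap : ∀ (i j : Fin n) → pack j i ≡ true · pack i j
pack-swap zero    zero    = refl
pack-swap zero    (suc j) = refl
pack-swap (suc i) zero    = refl
pack-swap (suc i) (suc j) = trans (cong shift (pack-swap i j)) (shift-· true (pack i j))

-- The outcome of `splitAt` is an explicit argument of `unpackSplit`, so that equations for it can
-- be substituted there.
unpack : PairPoints n → Fin n × Fin n
unpackSplit : Fin n ⊎ Fin (pairCount n) → Bool → Fin (suc n) × Fin (suc n)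

unpack         (inj₁ i)       = i , i
unpack {suc n} (inj₂ (o , s)) = unpackSplit (splitAt n o) s

unpackSplit (inj₁ i) false = zero , suc i
unpackSplit (inj₁ i) true  = suc i , zero
unpackSplit (inj₂ o) s     = Product.map suc suc (unpack (inj₂ (o , s)))

unpack-shift : ∀ (z : PairPoints n) → unpack (shift z) ≡ Product.map suc suc (unpack z)
unpack-shift         (inj₁ i)       = refl
unpack-shift {suc n} (inj₂ (o , s)) =
  cong (λ y → unpackSplit y s) (splitAt-↑ʳ (suc n) (pairCount (suc n)) o)

unpack-pack : ∀ (i j : Fin n) → unpack (pack i j) ≡ (i , j)
unpack-pack         zero    zero    = refl
unpack-pack {suc n} zero    (suc j) =
  cong (λ y → unpackSplit y false) (splitAt-↑ˡ n j (pairCount n))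
unpack-pack {suc n} (suc i) zero    =
  cong (λ y → unpackSplit y true) (splitAt-↑ˡ n i (pairCount n))
unpack-pack {suc n} (suc i) (suc j) =
  trans (unpack-shift (pack i j)) (cong (Product.map suc suc) (unpack-pack i j))

pack-unpack : ∀ (z : PairPoints n) → uncurry pack (unpack z) ≡ z
pack-unpackSplit : ∀ (y : Fin n ⊎ Fin (pairCount n)) s →
                   uncurry pack (unpackSplit y s) ≡ inj₂ (join n (pairCount n) y , s)
pack-unpack {suc n} (inj₁ zero)    = refl
pack-unpack {suc n} (inj₁ (suc i)) = cong shift (pack-unpack (inj₁ i))
pack-unpack {suc n} (inj₂ (o , s)) = trans (pack-unpackSplit (splitAt n o) s)
  (cong (λ o → inj₂ (o , s)) (join-splitAt n (pairCount n) o))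

pack-unpackSplit (inj₁ i) false = refl
pack-unpackSplit (inj₁ i) true  = refl
pack-unpackSplit (inj₂ o) s     = cong shift (pack-unpack (inj₂ (o , s)))

-- Principal right ideals and kernels.

-- A preimage under `f` is searched for in the finite set `A`; by the kernel inclusion the value of
-- `g` does not depend on which one is found. Off the image of `f` the value is `default`.
factor : ∀ {A B C : Set} → Fin m ↔ A → DecidableEquality B → (f : A → B) (g : A → C) → (B → C) →
         f ≲ g → ∃ λ h → h ∘ f ≗ g
factor {B = B} {C} Fin↔A _≟_ f g default f≲g = h , h-f
  where
  open Inverse Fin↔A

  h : B → C
  h y with any? (λ i → f (to i) ≟ y)
  ... | yes (i , _) = g (to i)
  ... | no _        = default y

  h-f : h ∘ f ≗ g
  h-f x with any? (λ i → f (to i) ≟ f x)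
  ... | yes (i , eq) = f≲g (to i) x eq
  ... | no none      = contradiction (from x , cong f (strictlyInverseˡ x)) none

module Ideals {a} (X : Set a) (n M : ℕ)
  (enc : X → X → Points (Fin n) (Fin M)) (dec : Points (Fin n) (Fin M) → X × X)
  (dec-enc : ∀ x y → dec (enc x y) ≡ (x , y)) (enc-dec : ∀ z → uncurry enc (dec z) ≡ z)
  (enc-swap : ∀ x y → enc y x ≡ true · enc x y) where

  open Quotients n M

  Fin↔Point : Fin (n + M * 2) ↔ Point
  Fin↔Point = +↔⊎ then (↔-id _ ⊎-↔ (*↔× then (↔-id _ ×-↔ 2↔Bool)))

  _≟_ : DecidableEquality Point
  _≟_ = Sum.≡-dec Fin._≟_ (Product.≡-dec Fin._≟_ Bool._≟_)

  enc-injective : ∀ {x y x′ y′} → enc x y ≡ enc x′ y′ → (x , y) ≡ (x′ , y′)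
  enc-injective {x} {y} {x′} {y′} eq =
    trans (sym (dec-enc x y)) (trans (cong dec eq) (dec-enc x′ y′))

  dec-swap : ∀ z → dec (true · z) ≡ swap (dec z)
  dec-swap z = trans (cong dec (sym (trans (enc-swap (proj₁ (dec z)) (proj₂ (dec z)))
    (cong (true ·_) (enc-dec z))))) (dec-enc _ _)

  -- The map from `(x , y)` to `(f x y , f y x)`, expressed on `Point`.
  action : Op₂ X → Point → Point
  action f z = let x , y = dec z in enc (f x y) (f y x)

  action-enc : ∀ f x y → action f (enc x y) ≡ enc (f x y) (f y x)
  action-enc f x y = cong (λ (x , y) → enc (f x y) (f y x)) (dec-enc x y)

  action-· : ∀ f b z → action f (b · z) ≡ b · action f z
  action-· f false z = trans (cong (action f) (false-· z)) (sym (false-· _))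
  action-· f true  z = trans (cong (λ (x , y) → enc (f x y) (f y x)) (dec-swap z)) (enc-swap _ _)

  -- The action of `f ▷ h` is that of `h` after that of `f`, so multiplication on the right can only
  -- enlarge the kernel.
  ∈⇒≲ : ∀ {f g} → g ∈ principalRightIdeal (𝓜 X) f → action f ≲ action g
  ∈⇒≲ {f} {g} (h , g≡f▷h) z z′ eq =
    trans (value z) (trans (cong (λ (u , v) → enc (h u v) (h v u)) (enc-injective eq))
      (sym (value z′)))
    where
    value : ∀ z → let x , y = dec z in
            action g z ≡ enc (h (f x y) (f y x)) (h (f y x) (f x y))
    value z = cong₂ enc (g≡f▷h _ _) (g≡f▷h _ _)

  -- The action of `g` factors through that of `f` by some `h`; the first coordinate of `h`, read as
  -- an operation, is the right multiplier.
  ≲⇒∈ : ∀ {f g} → action f ≲ action g → g ∈ principalRightIdeal (𝓜 X) f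
  ≲⇒∈ {f} {g} f≲g = (λ u v → proj₁ (dec (h (enc u v)))) , λ x y → sym
    (trans (cong (proj₁ ∘ dec ∘ h) (sym (action-enc f x y)))
    (trans (cong (proj₁ ∘ dec) (trans (h-f (enc x y)) (action-enc g x y)))
    (cong proj₁ (dec-enc (g x y) (g y x)))))
    where
    factorisation = factor Fin↔Point _≟_ (action f) (action g) id f≲g
    h   = proj₁ factorisation
    h-f = proj₂ factorisation

  ∈⇒⊆ : ∀ {f g} → g ∈ principalRightIdeal (𝓜 X) f →
        principalRightIdeal (𝓜 X) g ⊆ principalRightIdeal (𝓜 X) f
  ∈⇒⊆ (h , g≡f▷h) (k , y≡g▷k) = h ▷ k , λ x y → trans (y≡g▷k x y) (cong₂ k (g≡f▷h x y) (g≡f▷h y x))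

  self∈ : ∀ f → f ∈ principalRightIdeal (𝓜 X) f
  self∈ f = leftZeros , λ _ _ → refl

  -- The equivariant map with values `d` at the fixed points and `u` at the orbit representatives
  -- `(o , false)`.
  pointMap : Assignment n M 0 → Point → Point
  pointMap (d , u , w) (inj₁ i)       = inj₁ (d i)
  pointMap (d , u , w) (inj₂ (o , s)) = s · u o

  pointMap-· : ∀ t b z → pointMap t (b · z) ≡ b · pointMap t z
  pointMap-· t           b (inj₁ i)       = refl
  pointMap-· (d , u , w) b (inj₂ (o , s)) = ·-assoc b s (u o)

  operation : Assignment n M 0 → Op₂ X
  operation t x y = proj₁ (dec (pointMap t (enc x y)))

  -- The second coordinate of the action evaluates the operation at the interchanged pair;
  -- equivariance of `pointMap t` turns this into the second coordinate of its value.
  action-operation : ∀ t → action (operation t) ≗ pointMap t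
  action-operation t z = trans (cong₂ enc (cong (proj₁ ∘ dec ∘ pointMap t) (enc-dec z))
    (trans (cong (proj₁ ∘ dec ∘ pointMap t) (trans (enc-swap _ _) (cong (true ·_) (enc-dec z))))
    (trans (cong (proj₁ ∘ dec) (pointMap-· t true z)) (cong proj₁ (dec-swap (pointMap t z))))))
    (enc-dec (pointMap t z))

  -- A point of a free orbit is named by its orbit and sign, a fixed point by its index under either
  -- sign. Values agree under this naming, here and in the converse.
  pointMap⇒extend : ∀ s t → pointMap s ≲ pointMap t → extend (values s) ≲ extend (values t)
  pointMap⇒extend s t = ≲-reindex
    (λ { (_ , inj₁ i) → inj₁ i ; (b , inj₂ (inj₁ o)) → inj₂ (o , b) }) id id id
    (λ { (_ , inj₁ i) → refl ; (b , inj₂ (inj₁ o)) → refl })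
    (λ { (_ , inj₁ i) → refl ; (b , inj₂ (inj₁ o)) → refl })

  extend⇒pointMap : ∀ s t → extend (values s) ≲ extend (values t) → pointMap s ≲ pointMap t
  extend⇒pointMap s t = ≲-reindex
    (λ { (inj₁ i) → false , inj₁ i ; (inj₂ (o , b)) → b , inj₂ (inj₁ o) }) id id id
    (λ { (inj₁ i) → refl ; (inj₂ (o , b)) → refl })
    (λ { (inj₁ i) → refl ; (inj₂ (o , b)) → refl })

  module _ (f : Op₂ X) where
    -- An equivariant map sends fixed points to fixed points.
    fixedValue : ∀ i → ∃ λ k → action f (inj₁ i) ≡ inj₁ k
    fixedValue i = fixed (action f (inj₁ i)) (sym (action-· f true (inj₁ i)))

    assignment : Assignment n M 0
    assignment = proj₁ ∘ fixedValue , (λ o → action f (inj₂ (o , false))) , λ ()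

    pointMap-assignment : pointMap assignment ≗ action f
    pointMap-assignment (inj₁ i)       = sym (proj₂ (fixedValue i))
    pointMap-assignment (inj₂ (o , s)) = trans (sym (action-· f s (inj₂ (o , false))))
      (cong (λ b → action f (inj₂ (o , b))) (xor-identityʳ s))

  ≲-cong : ∀ {A B C : Set} {f f′ : A → B} {g g′ : A → C} → f ≗ f′ → g ≗ g′ → f ≲ g → f′ ≲ g′
  ≲-cong = ≲-reindex id id id id

  ideals : Inverse (PrincipalRightIdeals (𝓜 X)) (Quotients n M 0)
  ideals = reflecting⇒inverse (PrincipalRightIdeals (𝓜 X)) (Quotients n M 0)
    (λ t → principalRightIdeal (𝓜 X) (operation t) , operation t , ≐-refl)
    (λ {s} {t} (s≲t , t≲s) → ∈⇒⊆ (≲⇒∈ (actions t s t≲s)) , ∈⇒⊆ (≲⇒∈ (actions s t s≲t)))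
    (λ {s} {t} (s⊆t , t⊆s) →
      assignments s t (∈⇒≲ (t⊆s (self∈ (operation t)))) ,
      assignments t s (∈⇒≲ (s⊆t (self∈ (operation s)))))
    -- A generator `f` may be replaced by `operation (assignment f)`: both have the same action,
    -- hence generate the same ideal.
    (λ (I , f , I≐f) → assignment f , ≐-trans
      (∈⇒⊆ (≲⇒∈ (≲-cong (λ _ → refl) (λ z → sym (same f z)) (λ _ _ → id))) ,
       ∈⇒⊆ (≲⇒∈ (≲-cong (λ z → sym (same f z)) (λ _ → refl) (λ _ _ → id))))
      (≐-sym I≐f))
    where
    actions : ∀ s t → extend (values s) ≲ extend (values t) →
              action (operation s) ≲ action (operation t)
    actions s t s≲t = ≲-cong (sym ∘ action-operation s) (sym ∘ action-operation t)
      (extend⇒pointMap s t s≲t)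

    assignments : ∀ s t → action (operation s) ≲ action (operation t) →
                  extend (values s) ≲ extend (values t)
    assignments s t s≲t = pointMap⇒extend s t (≲-cong (action-operation s) (action-operation t) s≲t)

    same : ∀ f → action (operation (assignment f)) ≗ action f
    same f z = trans (action-operation (assignment f) z) (pointMap-assignment f z)

-- The inner sum starts at `m = 0` so that it equals 1 at `k = N`, where every free orbit is sent to
-- a fixed point; for `k < N` its term at `m = 0` vanishes.
theorem14 : ∀ {a} (X : Set a) (n : ℕ) .{{_ : NonZero n}} → HasCardinality (setoid X) n →
    let N = n C 2 in
    HasCardinality (PrincipalRightIdeals (𝓜 X))
    (∑[ c ∈ 1 ⋯ n ] ∑[ k ∈ 0 ⋯ N ]
    (N C k) * S (n + k) c * (∑[ m ∈ 0 ⋯ N ∸ k ] S (N ∸ k) m * 2 ^ (N ∸ k ∸ m)))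
theorem14 X n X↔Fin = subst (HasCardinality (PrincipalRightIdeals (𝓜 X)))
  (trans (cong total (pairCount≡nC2 n)) (sym (rearrange (n C 2))))
  (ideals then quotients-cardinality n (pairCount n) 0 (≤-reflexive (+-identityʳ (pairCount n))))
  where
  open Inverse X↔Fin
  open Quotients n (pairCount n)
  open Ideals X n (pairCount n) (λ x y → pack (to x) (to y)) (Product.map from from ∘ unpack)
    (λ x y → trans (cong (Product.map from from) (unpack-pack (to x) (to y)))
      (cong₂ _,_ (strictlyInverseʳ x) (strictlyInverseʳ y)))
    (λ z → trans (cong₂ pack (strictlyInverseˡ _) (strictlyInverseˡ _)) (pack-unpack z))
    (λ x y → pack-swap (to x) (to y))

  total : ℕ → ℕ
  total N = binomialSum N (λ k l → fixedCount (n + k) * freeCount (l + 0))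

  -- After exchanging the sums, `c` occurs only in `S (n + k) c`, so the sum over `c` collects into
  -- `fixedCount (n + k)`.
  rearrange : ∀ N →
    (∑[ c ∈ 1 ⋯ n ] ∑[ k ∈ 0 ⋯ N ] (N C k) * S (n + k) c * freeCount (N ∸ k)) ≡ total N
  rearrange N = trans
    (∑-swap (λ i k → (N C k) * S (n + k) (suc i) * freeCount (N ∸ k)) n (suc N))
    (∑-cong (suc N) λ {k} _ → trans
      (sym (∑-* (freeCount (N ∸ k)) (λ i → (N C k) * S (n + k) (suc i)) n))
      (trans (cong (_* freeCount (N ∸ k)) (sym (*-∑ (N C k) (λ i → S (n + k) (suc i)) n)))
      (trans (*-assoc (N C k) (fixedCount (n + k)) (freeCount (N ∸ k)))
      (cong (λ l → (N C k) * (fixedCount (n + k) * freeCount l)) (sym (+-identityʳ (N ∸ k)))))))
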